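{- There are, up to isomorphism, only finitely many excluded minors for the class of bicircular matroids that have rank less than ten.
   Context: All graphs and matroids are finite; graphs may have loops and multiple edges. The bicycles of a graph $G=(V,E)$ are the subgraphs of $G$ that are minimal with respect to having more edges than vertices. The bicircular matroid $B(G)$ is the matroid on ground set $E$ whose circuits are the edge sets of the bicycles of $G$. A loopless matroid is bicircular if it is isomorphic to $B(G)$ for some graph $G$. So that the class is minor-closed, loops are allowed: a general matroid is bicircular if deleting all its loops yields a matroid isomorphic to $B(G)$ for some graph $G$. An excluded minor for the class of bicircular matroids is a matroid that is not bicircular but all of whose proper minors are bicircular. -}

module Defs where

open import Data.Fin using (Fin)
open import Data.Fin.Subset
open import Data.Fin.Subset.Properties
open import Data.Nat using (ℕ; _+_; _∸_; _≤_; _<_)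
open import Data.Nat.Properties hiding (_≟_)
open import Data.Product using (Σ-syntax; ∃-syntax; _×_; _,_; proj₁)
open import Data.Sum using ([_,_]′)
open import Data.Vec using (tabulate)
open import Function using (_∘_; _⇔_; _↔_; Inverse)
open import Relation.Binary.PropositionalEquality
open import Relation.Nullary using (¬_; does)

-- A matroid is given by a ground set inside a set Fin n of labels and a rank
-- function. Letting the ground set be a subset of the labels means that minors
-- need no relabelling. The axioms concern subsets of the ground set only;
-- values of rank elsewhere carry no meaning, and _≅_ ignores them.
record Matroid (n : ℕ) : Set where
  field
    ground      : Subset n
    rank        : Subset n → ℕ
    bounded     : ∀ {X} → X ⊆ ground → rank X ≤ ∣ X ∣
    monotone    : ∀ {X Y} → X ⊆ Y → Y ⊆ ground → rank X ≤ rank Y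
    submodular  : ∀ {X Y} → X ⊆ ground → Y ⊆ ground →
                  rank (X ∪ Y) + rank (X ∩ Y) ≤ rank X + rank Y

open Matroid public

Element : ∀ {n} → Matroid n → Set
Element {n} M = Σ[ e ∈ Fin n ] e ∈ ground M

Independent : ∀ {n} → Matroid n → Subset n → Set
Independent M X = X ⊆ ground M × rank M X ≡ ∣ X ∣

Circuit : ∀ {n} → Matroid n → Subset n → Set
Circuit M X = X ⊆ ground M × ¬ Independent M X × (∀ Y → Y ⊂ X → Independent M Y)

-- The condition "∀ e → …" says that Y is the image of X under the bijection.
_≅_ : ∀ {m n} → Matroid m → Matroid n → Set
M ≅ N = Σ[ φ ∈ Element M ↔ Element N ]
  (∀ X Y → X ⊆ ground M → Y ⊆ ground N →
    (∀ (e : Element M) → proj₁ e ∈ X ⇔ proj₁ (Inverse.to φ e) ∈ Y) →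
    rank M X ≡ rank N Y)

delete : ∀ {n} → Matroid n → Subset n → Matroid n
delete M D = record
  { ground     = ground M ─ D
  ; rank       = rank M
  ; bounded    = λ X⊆ → bounded M (sub ∘ X⊆)
  ; monotone   = λ X⊆Y Y⊆ → monotone M X⊆Y (sub ∘ Y⊆)
  ; submodular = λ X⊆ Y⊆ → submodular M (sub ∘ X⊆) (sub ∘ Y⊆)
  }
  where
  sub : ground M ─ D ⊆ ground M
  sub = p─q⊆p (ground M) D

contract : ∀ {n} (M : Matroid n) (C : Subset n) → C ⊆ ground M → Matroid n
contract {n} M C C⊆E = record
  { ground     = ground M ─ C
  ; rank       = λ X → r (X ∪ C) ∸ r C
  ; bounded    = λ {X} X⊆ → m≤n+o⇒m∸n≤o (r (X ∪ C)) (r C) (begin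
      r (X ∪ C)                ≤⟨ m≤m+n _ _ ⟩
      r (X ∪ C) + r (X ∩ C)    ≤⟨ submodular M (sub ∘ X⊆) C⊆E ⟩
      r X + r C                ≤⟨ +-monoˡ-≤ (r C) (bounded M (sub ∘ X⊆)) ⟩
      ∣ X ∣ + r C              ≡⟨ +-comm ∣ X ∣ (r C) ⟩
      r C + ∣ X ∣              ∎)
  ; monotone   = λ {X} {Y} X⊆Y Y⊆ → ∸-monoˡ-≤ (r C)
      (monotone M (∪-least (p⊆p∪q C ∘ X⊆Y) (q⊆p∪q Y C)) (∪C⊆E Y⊆))
  ; submodular = λ {X} {Y} X⊆ Y⊆ →
      shift (above (∪-least X⊆ Y⊆)) (above (X⊆ ∘ p∩q⊆p X Y)) (above X⊆) (above Y⊆)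
        (subst₂ (λ A B → r A + r B ≤ r (X ∪ C) + r (Y ∪ C))
          (sym (∪-distrib-∪ X Y)) (sym (∪-distribʳ-∩ C X Y))
          (submodular M (∪C⊆E X⊆) (∪C⊆E Y⊆)))
  }
  where
  open ≤-Reasoning
  r : Subset n → ℕ
  r = rank M

  sub : ground M ─ C ⊆ ground M
  sub = p─q⊆p (ground M) C

  ∪-least : ∀ {X Y Z : Subset n} → X ⊆ Z → Y ⊆ Z → X ∪ Y ⊆ Z
  ∪-least {X} {Y} X⊆Z Y⊆Z = [ X⊆Z , Y⊆Z ]′ ∘ x∈p∪q⁻ X Y

  ∪C⊆E : ∀ {X} → X ⊆ ground M ─ C → X ∪ C ⊆ ground M
  ∪C⊆E X⊆ = ∪-least (sub ∘ X⊆) C⊆E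

  above : ∀ {X} → X ⊆ ground M ─ C → r C ≤ r (X ∪ C)
  above {X} X⊆ = monotone M (q⊆p∪q X C) (∪C⊆E X⊆)

  ∪-distrib-∪ : ∀ X Y → (X ∪ Y) ∪ C ≡ (X ∪ C) ∪ (Y ∪ C)
  ∪-distrib-∪ X Y = ⊆-antisym
    (∪-least (∪-least (p⊆p∪q (Y ∪ C) ∘ p⊆p∪q C) (q⊆p∪q (X ∪ C) (Y ∪ C) ∘ p⊆p∪q C))
             (q⊆p∪q (X ∪ C) (Y ∪ C) ∘ q⊆p∪q Y C))
    (∪-least (∪-least (p⊆p∪q C ∘ p⊆p∪q Y) (q⊆p∪q (X ∪ Y) C))
             (∪-least (p⊆p∪q C ∘ q⊆p∪q X Y) (q⊆p∪q (X ∪ Y) C)))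

  shift : ∀ {a b c d k} → k ≤ a → k ≤ b → k ≤ c → k ≤ d →
          a + b ≤ c + d → (a ∸ k) + (b ∸ k) ≤ (c ∸ k) + (d ∸ k)
  shift {a} {b} {c} {d} {k} k≤a k≤b k≤c k≤d ab≤cd = begin
    (a ∸ k) + (b ∸ k)   ≡⟨ both k≤a k≤b ⟩
    (a + b) ∸ k ∸ k     ≤⟨ ∸-monoˡ-≤ k (∸-monoˡ-≤ k ab≤cd) ⟩
    (c + d) ∸ k ∸ k     ≡⟨ both k≤c k≤d ⟨
    (c ∸ k) + (d ∸ k)   ∎
    where
    both : ∀ {x y} → k ≤ x → k ≤ y → (x ∸ k) + (y ∸ k) ≡ (x + y) ∸ k ∸ k
    both {x} {y} k≤x k≤y = begin-equality
      (x ∸ k) + (y ∸ k)   ≡⟨ +-∸-assoc (x ∸ k) k≤y ⟨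
      ((x ∸ k) + y) ∸ k   ≡⟨ cong (_∸ k) (+-∸-comm y k≤x) ⟨
      (x + y) ∸ k ∸ k     ∎

loops : ∀ {n} → Matroid n → Subset n
loops M = ground M ∩ tabulate (λ e → does (rank M ⁅ e ⁆ ≟ 0))
  where open import Data.Nat using (_≟_)

-- The two ends of an edge are listed in an arbitrary order. An edge with equal
-- ends is a loop, and parallel edges are allowed.
record Graph : Set where
  field
    #V #E : ℕ
    end₁ end₂ : Fin #E → Fin #V

open Graph public

record Subgraph (G : Graph) : Set where
  field
    vertices : Subset (#V G)
    edges    : Subset (#E G)
    closed₁  : ∀ {e} → e ∈ edges → end₁ G e ∈ vertices
    closed₂  : ∀ {e} → e ∈ edges → end₂ G e ∈ vertices

open Subgraph public

_≼_ : ∀ {G} → Subgraph G → Subgraph G → Set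
H ≼ K = vertices H ⊆ vertices K × edges H ⊆ edges K

MoreEdges : ∀ {G} → Subgraph G → Set
MoreEdges H = ∣ vertices H ∣ < ∣ edges H ∣

Bicycle : ∀ {G} → Subgraph G → Set
Bicycle {G} H = MoreEdges H × (∀ (K : Subgraph G) → K ≼ H → MoreEdges K → H ≼ K)

-- B is the matroid B(G). A matroid is determined by its ground set and its
-- circuits, so at most one matroid, up to values of rank that carry no meaning,
-- satisfies this.
IsBicircularMatroidOf : (G : Graph) → Matroid (#E G) → Set
IsBicircularMatroidOf G B =
  ground B ≡ ⊤ ×
  (∀ X → Circuit B X ⇔ (∃[ H ] (Bicycle {G} H × edges H ≡ X)))

Bicircular : ∀ {n} → Matroid n → Set
Bicircular M =
  ∃[ G ] ∃[ B ] (IsBicircularMatroidOf G B × delete M (loops M) ≅ B)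

ExcludedMinor : ∀ {n} → Matroid n → Set
ExcludedMinor {n} M =
  ¬ Bicircular M ×
  (∀ (C D : Subset n) (C⊆E : C ⊆ ground M) → D ⊆ ground M → Empty (C ∩ D) →
    Nonempty (C ∪ D) → Bicircular (delete (contract M C C⊆E) D))

{-# OPTIONS --safe #-}
module Submission where

-- An excluded minor M has no loop, and each deletion M \ x is the bicircular
-- matroid of a graph G_x. If r bounds the rank, the edges of G_x have their ends
-- among 2r vertices, so any large set of elements contains a large class of
-- edges that are parallel in G_x. Repeating this for r + 1 elements x gives a
-- large class Q of elements that may be exchanged for one another in any
-- independent set avoiding one of these x. An independent set has at most r
-- elements, so it avoids one of them, and the elements of Q are clones in M. For
-- f in Q, some three elements of Q are parallel in G_f, and G_f together with
-- an edge f parallel to these three represents M, which is absurd. Hence the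
-- size of M is bounded in terms of r.

open import Defs
open import Data.Empty using (⊥-elim)
open import Data.Fin using (Fin; zero; suc)
import Data.Fin as Fin
open import Data.Fin.Properties using (any?; suc-injective)
open import Data.Fin.Subset
open import Data.Fin.Subset.Properties
open import Data.List using (List; []; _∷_; length; upTo; concatMap)
import Data.List as List
import Data.List.Membership.DecPropositional as DecMembership
open import Data.List.Membership.Propositional using () renaming (_∈_ to _∈ˡ_)
open import Data.List.Membership.Propositional.Properties using (∈-upTo⁺)
open import Data.List.Relation.Unary.Any using (Any; here; there)
import Data.List.Relation.Unary.Any as Any
open import Data.List.Relation.Unary.Any.Properties using (concatMap⁺; map⁺)
open import Data.Nat using (ℕ; zero; suc; _+_; _*_; _∸_; _≤_; _<_; z≤n; s≤s; s≤s⁻¹; _<?_; _≤?_; _≟_)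
open import Data.Nat.Properties hiding (_≟_; _≤?_; _<?_; suc-injective)
open import Data.Product using (Σ; ∃; Σ-syntax; ∃-syntax; _×_; _,_; proj₁; proj₂)
open import Data.Sum using (_⊎_; inj₁; inj₂; [_,_]′)
open import Data.Vec using ([]; _∷_; tabulate; here; there; tail)
open import Data.Vec.Properties using (lookup∘tabulate; []=⇒lookup; lookup⇒[]=)
open import Data.Vec.Properties.WithK using ([]=-irrelevant)
open import Function using (_∘_; id; _⇔_; mk⇔; Equivalence; _↔_; mk↔ₛ′; Inverse; Injection)
open import Function.Properties.Equivalence using () renaming (trans to ⇔-trans)
open import Function.Properties.Inverse using (↔⇒↣)
open import Relation.Nullary using (¬_; Dec; yes; no; does)
open import Relation.Nullary.Decidable using (_×-dec_; _→-dec_; ¬?; decidable-stable; dec-true)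
open import Relation.Unary using (Decidable)
open import Relation.Binary.PropositionalEquality

open Equivalence using (to; from)

private variable
  n m k l : ℕ

-- Finite sets and their sizes.

comprehension : {P : Fin n → Set} → Decidable P → Subset n
comprehension P? = tabulate (does ∘ P?)

∈-comprehension : {P : Fin n → Set} (P? : Decidable P) {x : Fin n} →
                  x ∈ comprehension P? ⇔ P x
∈-comprehension {P = P} P? {x} = mk⇔ ⇒ ⇐
  where
  ⇒ : x ∈ comprehension P? → P x
  ⇒ x∈ with P? x | trans (sym (lookup∘tabulate (does ∘ P?) x)) ([]=⇒lookup x∈)
  ... | yes p | _ = p
  ⇐ : P x → x ∈ comprehension P?
  ⇐ p = lookup⇒[]= x _ (trans (lookup∘tabulate (does ∘ P?) x) (dec-true (P? x) p))

∪-least : {p q r : Subset n} → p ⊆ r → q ⊆ r → p ∪ q ⊆ r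
∪-least p⊆r q⊆r = [ p⊆r , q⊆r ]′ ∘ x∈p∪q⁻ _ _

⁅x⁆⊆ : {x : Fin n} {p : Subset n} → x ∈ p → ⁅ x ⁆ ⊆ p
⁅x⁆⊆ {p = p} x∈p y∈ = subst (_∈ p) (sym (x∈⁅y⁆⇒x≡y _ y∈)) x∈p

∪⁅x⁆-elim : ∀ {p x} (P : Fin n → Set) → (∀ {y} → y ∈ p → P y) → P x → ∀ {y} → y ∈ p ∪ ⁅ x ⁆ → P y
∪⁅x⁆-elim {p = p} {x} P on-p at-x y∈ with x∈p∪q⁻ p _ y∈
... | inj₁ y∈p = on-p y∈p
... | inj₂ y∈x = subst P (sym (x∈⁅y⁆⇒x≡y x y∈x)) at-x

x∈p─q⇒x∉q : ∀ (p q : Subset n) {x} → x ∈ p ─ q → x ∉ q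
x∈p─q⇒x∉q (_ ∷ p) (inside  ∷ q) (there x∈) (there x∈q) = x∈p─q⇒x∉q p q x∈ x∈q
x∈p─q⇒x∉q (_ ∷ p) (outside ∷ q) (there x∈) (there x∈q) = x∈p─q⇒x∉q p q x∈ x∈q

x∉p-x : ∀ (p : Subset n) x → x ∉ p - x
x∉p-x p x x∈ = x∈p─q⇒x∉q p ⁅ x ⁆ x∈ (x∈⁅x⁆ x)

∣p∣≡∣p∩q∣+∣p─q∣ : ∀ (p q : Subset n) → ∣ p ∣ ≡ ∣ p ∩ q ∣ + ∣ p ─ q ∣
∣p∣≡∣p∩q∣+∣p─q∣ []            []            = refl
∣p∣≡∣p∩q∣+∣p─q∣ (inside  ∷ p) (inside  ∷ q) = cong suc (∣p∣≡∣p∩q∣+∣p─q∣ p q)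
∣p∣≡∣p∩q∣+∣p─q∣ (inside  ∷ p) (outside ∷ q) =
  trans (cong suc (∣p∣≡∣p∩q∣+∣p─q∣ p q)) (sym (+-suc _ _))
∣p∣≡∣p∩q∣+∣p─q∣ (outside ∷ p) (inside  ∷ q) = ∣p∣≡∣p∩q∣+∣p─q∣ p q
∣p∣≡∣p∩q∣+∣p─q∣ (outside ∷ p) (outside ∷ q) = ∣p∣≡∣p∩q∣+∣p─q∣ p q

∣p∣≤1+∣p-x∣ : ∀ (p : Subset n) x → ∣ p ∣ ≤ suc ∣ p - x ∣
∣p∣≤1+∣p-x∣ p x = ≤-trans (≤-reflexive (∣p∣≡∣p∩q∣+∣p─q∣ p ⁅ x ⁆))
  (+-monoˡ-≤ _ (≤-trans (∣p∩q∣≤∣q∣ p ⁅ x ⁆) (≤-reflexive (∣⁅x⁆∣≡1 x))))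

∣p∪q∣≤∣p∣+∣q∣ : ∀ (p q : Subset n) → ∣ p ∪ q ∣ ≤ ∣ p ∣ + ∣ q ∣
∣p∪q∣≤∣p∣+∣q∣ []            []            = z≤n
∣p∪q∣≤∣p∣+∣q∣ (inside  ∷ p) (inside  ∷ q) =
  s≤s (≤-trans (∣p∪q∣≤∣p∣+∣q∣ p q) (+-monoʳ-≤ ∣ p ∣ (m≤n⇒m≤1+n ≤-refl)))
∣p∪q∣≤∣p∣+∣q∣ (inside  ∷ p) (outside ∷ q) = s≤s (∣p∪q∣≤∣p∣+∣q∣ p q)
∣p∪q∣≤∣p∣+∣q∣ (outside ∷ p) (inside  ∷ q) =
  ≤-trans (s≤s (∣p∪q∣≤∣p∣+∣q∣ p q)) (≤-reflexive (sym (+-suc _ _)))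
∣p∪q∣≤∣p∣+∣q∣ (outside ∷ p) (outside ∷ q) = ∣p∪q∣≤∣p∣+∣q∣ p q

x∉p⇒∣p∣<∣p∪⁅x⁆∣ : ∀ {x} (p : Subset n) → x ∉ p → ∣ p ∣ < ∣ p ∪ ⁅ x ⁆ ∣
x∉p⇒∣p∣<∣p∪⁅x⁆∣ {x = x} p x∉p =
  p⊂q⇒∣p∣<∣q∣ (p⊆p∪q ⁅ x ⁆ , x , q⊆p∪q p ⁅ x ⁆ (x∈⁅x⁆ x) , x∉p)

p-x∪⁅x⁆≡p : ∀ {x} {p : Subset n} → x ∈ p → (p - x) ∪ ⁅ x ⁆ ≡ p
p-x∪⁅x⁆≡p {x = x} {p} x∈p = ⊆-antisym (∪-least (p─q⊆p p ⁅ x ⁆) (⁅x⁆⊆ x∈p)) ⇐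
  where
  ⇐ : p ⊆ (p - x) ∪ ⁅ x ⁆
  ⇐ {y} y∈p with y Fin.≟ x
  ... | yes refl = q⊆p∪q (p - x) ⁅ x ⁆ (x∈⁅x⁆ x)
  ... | no y≢x   = p⊆p∪q ⁅ x ⁆ (x∈p∧x≢y⇒x∈p-y y∈p y≢x)

∣p∣<∣q∣⇒∃ : ∀ (p q : Subset n) → ∣ p ∣ < ∣ q ∣ → ∃ λ x → x ∈ q × x ∉ p
∣p∣<∣q∣⇒∃ p q p<q with any? (λ x → (x ∈? q) ×-dec ¬? (x ∈? p))
... | yes w = w
... | no ∄  = ⊥-elim (<⇒≱ p<q (p⊆q⇒∣p∣≤∣q∣ λ {x} x∈q →
                decidable-stable (x ∈? p) λ x∉p → ∄ (x , x∈q , x∉p)))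

-- Fibres and the pigeonhole principle.

level : (Fin n → Fin m) → Fin m → Subset n
level f v = comprehension (λ x → f x Fin.≟ v)

∈-level : ∀ (f : Fin n → Fin m) {v x} → x ∈ level f v ⇔ f x ≡ v
∈-level f {v} = ∈-comprehension (λ x → f x Fin.≟ v)

0<∣p∣⇒nonempty : ∀ (p : Subset n) → 0 < ∣ p ∣ → Nonempty p
0<∣p∣⇒nonempty {n} p 0<p with ∣p∣<∣q∣⇒∃ ⊥ p (subst (_< ∣ p ∣) (sym (∣⊥∣≡0 n)) 0<p)
... | x , x∈p , _ = x , x∈p

fibre : (Fin n → Fin m) → Subset n → Fin m → Subset n
fibre f P v = P ∩ level f v

∈-fibre : ∀ (f : Fin n → Fin m) P v {x} → x ∈ fibre f P v → x ∈ P × f x ≡ v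
∈-fibre f P v x∈ with x∈p∩q⁻ P _ x∈
... | x∈P , x∈c = x∈P , to (∈-level f) x∈c

fibre-mono : ∀ (f : Fin n → Fin m) v {P Q} → P ⊆ Q → fibre f P v ⊆ fibre f Q v
fibre-mono f v {P} P⊆Q x∈ with x∈p∩q⁻ P _ x∈
... | x∈P , x∈c = x∈p∩q⁺ (P⊆Q x∈P , x∈c)

-- Only the values in the list `vs` count, so the bound does not depend on `m`. A fibre with at most
-- `b` elements is removed together with its value, and more than `b` elements per remaining value
-- are left.
pigeonhole : ∀ (f : Fin n → Fin m) b vs (P : Subset n) → (∀ {x} → x ∈ P → f x ∈ˡ vs) →
             length vs * b < ∣ P ∣ → ∃ λ v → b < ∣ fibre f P v ∣
pigeonhole f b [] P f∈ 0<P with 0<∣p∣⇒nonempty P 0<P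
... | x , x∈P with f∈ x∈P
... | ()
pigeonhole f b (v ∷ vs) P f∈ big with b <? ∣ fibre f P v ∣
... | yes b< = v , b<
... | no b≮ with pigeonhole f b vs (P ─ C) rest big′
  where
  C = level f v
  rest : ∀ {x} → x ∈ P ─ C → f x ∈ˡ vs
  rest x∈ with f∈ (p─q⊆p P C x∈)
  ... | here fx≡v = ⊥-elim (x∈p─q⇒x∉q P C x∈ (from (∈-level f) fx≡v))
  ... | there fx∈ = fx∈
  big′ : length vs * b < ∣ P ─ C ∣
  big′ = ≰⇒> λ small → <⇒≱ big
    (≤-trans (≤-reflexive (∣p∣≡∣p∩q∣+∣p─q∣ P C)) (+-mono-≤ (≮⇒≥ b≮) small))
... | w , b< = w , ≤-trans b< 
  (p⊆q⇒∣p∣≤∣q∣ {p = fibre f (P ─ level f v) w} (fibre-mono f w (p─q⊆p P (level f v))))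

-- Sparse edge sets of a graph.

Covers : (s t : Fin n → Fin m) → Subset m → Subset n → Set
Covers s t W Y = ∀ {e} → e ∈ Y → s e ∈ W × t e ∈ W

-- Independence in the bicircular matroid of the graph in which the edge e joins
-- s e to t e: no subgraph with edge set inside X has more edges than vertices.
Sparse : (s t : Fin n → Fin m) → Subset n → Set
Sparse s t X = ∀ Y W → Y ⊆ X → Covers s t W Y → ∣ Y ∣ ≤ ∣ W ∣

sparse-⊆ : ∀ {s t : Fin n → Fin m} {X Y} → Y ⊆ X → Sparse s t X → Sparse s t Y
sparse-⊆ Y⊆X sp Z W Z⊆Y = sp Z W (Y⊆X ∘ Z⊆Y)

sparse-cong : ∀ {s t s′ t′ : Fin n → Fin m} {X} →
              (∀ {e} → e ∈ X → s′ e ≡ s e × t′ e ≡ t e) → Sparse s t X → Sparse s′ t′ X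
sparse-cong same sp Y W Y⊆X cov = sp Y W Y⊆X λ e∈Y →
  let s≡ , t≡ = same (Y⊆X e∈Y) ; s∈ , t∈ = cov e∈Y in subst (_∈ W) s≡ s∈ , subst (_∈ W) t≡ t∈

sparse-⊥ : ∀ {s t : Fin n → Fin m} → Sparse s t ⊥
sparse-⊥ {n = n} Y W Y⊆⊥ _ = ≤-trans (p⊆q⇒∣p∣≤∣q∣ Y⊆⊥) (≤-trans (≤-reflexive (∣⊥∣≡0 n)) z≤n)

-- Replacing `q` by the parallel edge `f` in a set `Y` keeps it covered by the same `W`. The size of
-- `Y` does not drop, since `f` lies outside `A`.
sparse-exchange : ∀ {s t : Fin n → Fin m} {A f q} → s f ≡ s q → t f ≡ t q → f ∉ A →
                  Sparse s t (A ∪ ⁅ f ⁆) → Sparse s t (A ∪ ⁅ q ⁆)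
sparse-exchange {s = s} {t} {A} {f} {q} s≡ t≡ f∉A sp Y W Y⊆ cov with q ∈? Y
... | no q∉Y = sp Y W (p⊆p∪q ⁅ f ⁆ ∘ Y⊆A) cov
  where
  Y⊆A : Y ⊆ A
  Y⊆A y∈Y with x∈p∪q⁻ A _ (Y⊆ y∈Y)
  ... | inj₁ y∈A = y∈A
  ... | inj₂ y∈q = ⊥-elim (q∉Y (subst (_∈ Y) (x∈⁅y⁆⇒x≡y q y∈q) y∈Y))
... | yes q∈Y = begin
  ∣ Y ∣                    ≤⟨ ∣p∣≤1+∣p-x∣ Y q ⟩
  suc ∣ Y - q ∣            ≤⟨ x∉p⇒∣p∣<∣p∪⁅x⁆∣ (Y - q) (f∉A ∘ Y-q⊆A) ⟩
  ∣ (Y - q) ∪ ⁅ f ⁆ ∣      ≤⟨ sp _ W (∪-least (p⊆p∪q ⁅ f ⁆ ∘ Y-q⊆A) (q⊆p∪q A ⁅ f ⁆)) cov′ ⟩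
  ∣ W ∣                    ∎
  where
  open ≤-Reasoning
  Y-q⊆A : Y - q ⊆ A
  Y-q⊆A y∈ with x∈p∪q⁻ A _ (Y⊆ (p─q⊆p Y ⁅ q ⁆ y∈))
  ... | inj₁ y∈A = y∈A
  ... | inj₂ y∈q = ⊥-elim (x∈p─q⇒x∉q Y ⁅ q ⁆ y∈ y∈q)
  cov′ : Covers s t W ((Y - q) ∪ ⁅ f ⁆)
  cov′ y∈ with x∈p∪q⁻ (Y - q) _ y∈
  ... | inj₁ y∈Y = cov (p─q⊆p Y ⁅ q ⁆ y∈Y)
  ... | inj₂ y∈f with x∈⁅y⁆⇒x≡y f y∈f
  ... | refl = subst (_∈ W) (sym s≡) (proj₁ (cov q∈Y)) , subst (_∈ W) (sym t≡) (proj₂ (cov q∈Y))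

-- The end `v` of `e` meets no edge of `I`. A covered set that contains `e` uses `v`, and removing
-- both `e` and `v` leaves a set inside `I` that is still covered.
sparse-insert : ∀ {s t : Fin n → Fin m} {I e v} → (v ≡ s e) ⊎ (v ≡ t e) →
                (∀ {i} → i ∈ I → s i ≢ v × t i ≢ v) →
                Sparse s t I → Sparse s t (I ∪ ⁅ e ⁆)
sparse-insert {s = s} {t} {I} {e} {v} v-end new sp Y W Y⊆ cov with e ∈? Y
... | no e∉Y = sp Y W Y⊆I cov
  where
  Y⊆I : Y ⊆ I
  Y⊆I y∈Y with x∈p∪q⁻ I _ (Y⊆ y∈Y)
  ... | inj₁ y∈I = y∈I
  ... | inj₂ y∈e = ⊥-elim (e∉Y (subst (_∈ Y) (x∈⁅y⁆⇒x≡y e y∈e) y∈Y))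
... | yes e∈Y = begin
  ∣ Y ∣            ≤⟨ ∣p∣≤1+∣p-x∣ Y e ⟩
  suc ∣ Y - e ∣    ≤⟨ s≤s (sp (Y - e) (W - v) Y-e⊆I cov′) ⟩
  suc ∣ W - v ∣    ≤⟨ x∈p⇒∣p-x∣<∣p∣ v∈W ⟩
  ∣ W ∣            ∎
  where
  open ≤-Reasoning
  v∈W : v ∈ W
  v∈W = [ (λ { refl → proj₁ (cov e∈Y) }) , (λ { refl → proj₂ (cov e∈Y) }) ]′ v-end
  Y-e⊆I : Y - e ⊆ I
  Y-e⊆I y∈ with x∈p∪q⁻ I _ (Y⊆ (p─q⊆p Y ⁅ e ⁆ y∈))
  ... | inj₁ y∈I = y∈I
  ... | inj₂ y∈e = ⊥-elim (x∈p─q⇒x∉q Y ⁅ e ⁆ y∈ y∈e)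
  cov′ : Covers s t (W - v) (Y - e)
  cov′ y∈ with cov (p─q⊆p Y ⁅ e ⁆ y∈) | new (Y-e⊆I y∈)
  ... | s∈ , t∈ | s≢ , t≢ = x∈p∧x≢y⇒x∈p-y s∈ s≢ , x∈p∧x≢y⇒x∈p-y t∈ t≢

-- Representation by graphs and the size bound.

-- `Dom` selects the sets on which the graph has to be right. A graph for a deletion thus keeps all
-- labels, and its edges for elements outside the deletion are arbitrary.
record Represents (Ind : Subset n → Set) (Dom : Subset n → Set) : Set where
  field
    {#vertices}   : ℕ
    source target : Fin n → Fin #vertices
    correct       : ∀ {X} → Dom X → Ind X ⇔ Sparse source target X

open Represents

-- One round sets aside one element, whence the `suc`, and then fixes the source and the target of
-- the edges, each among at most `2 * r` vertices.
threshold : ℕ → ℕ → ℕ → ℕ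
threshold r b zero    = b
threshold r b (suc k) = suc (2 * r * (2 * r * threshold r b k))

-- After `suc r` rounds, no independent set contains all the elements set aside. The remaining class
-- is so large that, without one further element `f`, it still has more than two parallel edges.
size-bound : ℕ → ℕ
size-bound r = threshold r (suc (2 * r * (2 * r * 2))) (suc r)

module _ (E : Subset n) (Ind : Subset n → Set) (r : ℕ)
         (ind-size : ∀ {X} → Ind X → ∣ X ∣ ≤ r)
         (ind-⊆ : ∀ {X Y} → Y ⊆ X → Ind X → Ind Y)
         where

  -- Few vertices and large parallel classes.

  Avoiding : Fin n → Subset n → Set
  Avoiding x X = X ⊆ E × x ∉ X

  module _ {x : Fin n} (R : Represents Ind (Avoiding x)) where
    private
      s = source R
      t = target R
      open DecMembership (Fin._≟_ {#vertices R}) using () renaming (_∈?_ to _∈ˡ?_)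

    -- Any edge with an end outside the list can be added to the sparse set I.
    few-vertices-from : ∀ k I vs → Avoiding x I → Sparse s t I → r < k + ∣ I ∣ →
                        (∀ {i} → i ∈ I → s i ∈ˡ vs × t i ∈ˡ vs) → length vs ≤ 2 * ∣ I ∣ →
                        ∃ λ vs → length vs ≤ 2 * r ×
                                 (∀ {P} → Avoiding x P → ∀ {e} → e ∈ P → s e ∈ˡ vs × t e ∈ˡ vs)
    -- The fuel `k` runs out only when `I` has more than `r` elements, which its independence
    -- forbids.
    few-vertices-from zero I vs dom sp r< _ _ =
      ⊥-elim (<⇒≱ r< (ind-size (from (correct R dom) sp)))
    few-vertices-from (suc k) I vs dom@(I⊆E , x∉I) sp r< ends len
      with any? (λ e → (e ∈? (E - x)) ×-dec ¬? ((s e ∈ˡ? vs) ×-dec (t e ∈ˡ? vs)))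
    ... | no ∄ = vs , ≤-trans len (*-monoʳ-≤ 2 (ind-size (from (correct R dom) sp))) ,
      λ (P⊆E , x∉P) {e} e∈P → decidable-stable ((s e ∈ˡ? vs) ×-dec (t e ∈ˡ? vs)) λ e-new →
        ∄ (e , x∈p∧x≢y⇒x∈p-y (P⊆E e∈P) (λ { refl → x∉P e∈P }) , e-new)
    ... | yes (e , e∈ , e-new) = few-vertices-from k (I ∪ ⁅ e ⁆) (s e ∷ t e ∷ vs)
      (∪-least I⊆E (⁅x⁆⊆ (p─q⊆p E ⁅ x ⁆ e∈)) , x∉)
      sp′ (≤-trans r< (≤-trans (≤-reflexive (sym (+-suc k _))) (+-monoʳ-≤ k I<)))
      ends′ (≤-trans (s≤s (s≤s len)) (≤-trans (≤-reflexive (sym (*-suc 2 ∣ I ∣))) (*-monoʳ-≤ 2 I<)))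
      where
      I< : ∣ I ∣ < ∣ I ∪ ⁅ e ⁆ ∣
      I< = x∉p⇒∣p∣<∣p∪⁅x⁆∣ I (e-new ∘ ends)
      x∉ : x ∉ I ∪ ⁅ e ⁆
      x∉ x∈ with x∈p∪q⁻ I _ x∈
      ... | inj₁ x∈I = x∉I x∈I
      ... | inj₂ x∈e with x∈⁅y⁆⇒x≡y e x∈e
      ... | refl = x∉p-x E x e∈
      sp′ : Sparse s t (I ∪ ⁅ e ⁆)
      sp′ with s e ∈ˡ? vs
      ... | no s∉ = sparse-insert (inj₁ refl)
        (λ i∈ → (λ eq → s∉ (subst (_∈ˡ vs) eq (proj₁ (ends i∈))))
              , (λ eq → s∉ (subst (_∈ˡ vs) eq (proj₂ (ends i∈))))) sp
      ... | yes s∈ = sparse-insert (inj₂ refl)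
        (λ i∈ → (λ eq → e-new (s∈ , subst (_∈ˡ vs) eq (proj₁ (ends i∈))))
              , (λ eq → e-new (s∈ , subst (_∈ˡ vs) eq (proj₂ (ends i∈))))) sp
      ends′ : ∀ {i} → i ∈ I ∪ ⁅ e ⁆ → s i ∈ˡ s e ∷ t e ∷ vs × t i ∈ˡ s e ∷ t e ∷ vs
      ends′ i∈ with x∈p∪q⁻ I _ i∈
      ... | inj₁ i∈I = there (there (proj₁ (ends i∈I))) , there (there (proj₂ (ends i∈I)))
      ... | inj₂ i∈e with x∈⁅y⁆⇒x≡y e i∈e
      ... | refl = here refl , there (here refl)

    -- A sparse set grown greedily from the empty set stops with at most `r` edges. Every other edge
    -- then has both ends among their at most `2 * r` ends.
    few-vertices : ∃ λ vs → length vs ≤ 2 * r ×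
                   (∀ {P} → Avoiding x P → ∀ {e} → e ∈ P → s e ∈ˡ vs × t e ∈ˡ vs)
    few-vertices = few-vertices-from (suc r) ⊥ [] ((λ i∈ → ⊥-elim (∉⊥ i∈)) , ∉⊥) sparse-⊥
      (s≤s (≤-trans (≤-reflexive (sym (+-identityʳ r))) (+-monoʳ-≤ r z≤n)))
      (λ i∈ → ⊥-elim (∉⊥ i∈)) z≤n

    record ParallelClass (b : ℕ) (P : Subset n) : Set where
      field
        class    : Subset n
        class⊆   : class ⊆ P
        big      : b < ∣ class ∣
        u v      : Fin (#vertices R)
        parallel : ∀ {q} → q ∈ class → s q ≡ u × t q ≡ v

    -- The pigeonhole principle is applied to the sources, and then to the targets within one fibre
    -- of the sources. This accounts for the two factors `2 * r`.
    parallel-class : ∀ b P → Avoiding x P → 2 * r * (2 * r * b) < ∣ P ∣ → ParallelClass b P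
    parallel-class b P dom big with few-vertices
    ... | vs , len , ends
      with pigeonhole s (2 * r * b) vs P (proj₁ ∘ ends dom) (≤-<-trans (*-monoˡ-≤ _ len) big)
    ... | u , big₁
      with pigeonhole t b vs (fibre s P u)
             (λ e∈ → proj₂ (ends dom (proj₁ (∈-fibre s P u e∈)))) (≤-<-trans (*-monoˡ-≤ b len) big₁)
    ... | v , big₂ = record
      { class    = fibre t (fibre s P u) v
      ; class⊆   = proj₁ ∘ ∈-fibre s P u ∘ proj₁ ∘ ∈-fibre t (fibre s P u) v
      ; big      = big₂
      ; parallel = λ q∈ → let q∈₁ , t≡ = ∈-fibre t (fibre s P u) v q∈ in
                          proj₂ (∈-fibre s P u q∈₁) , t≡
      }

  -- Clones.

  -- Clones in the sense of matroid theory, for exchanges whose common part `A` satisfies `Dom`. If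
  -- `f` were in `A`, the claim would enlarge an independent set rather than exchange an element.
  Clones : (Subset n → Set) → Subset n → Set
  Clones Dom Q = ∀ {f q A} → f ∈ Q → q ∈ Q → f ∉ A → Dom A →
                 Ind (A ∪ ⁅ f ⁆) → Ind (A ∪ ⁅ q ⁆)

  parallel⇒clones : ∀ {x} (R : Represents Ind (Avoiding x)) {Q u v} → Avoiding x Q →
                    (∀ {q} → q ∈ Q → source R q ≡ u × target R q ≡ v) → Clones (Avoiding x) Q
  parallel⇒clones {x} R {Q} (Q⊆E , x∉Q) par {f} {q} {A} f∈ q∈ f∉A (A⊆E , x∉A) ind =
    from (correct R (dom q∈))
      (sparse-exchange (trans (proj₁ (par f∈)) (sym (proj₁ (par q∈))))
                       (trans (proj₂ (par f∈)) (sym (proj₂ (par q∈)))) f∉A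
                       (to (correct R (dom f∈)) ind))
    where
    dom : ∀ {e} → e ∈ Q → Avoiding x (A ∪ ⁅ e ⁆)
    dom {e} e∈ = ∪-least A⊆E (⁅x⁆⊆ (Q⊆E e∈)) ,
      λ x∈ → [ x∉A , (λ x∈e → x∉Q (subst (_∈ Q) (sym (x∈⁅y⁆⇒x≡y e x∈e)) e∈)) ]′ (x∈p∪q⁻ A _ x∈)

  -- The independent set `A ∪ ⁅ f ⁆` has at most `r` elements and so misses some `x` in `S`. The
  -- exchange then takes place within the sets that avoid `x`.
  clones-everywhere : ∀ {S Q} → r < ∣ S ∣ → (∀ {x} → x ∈ S → Clones (Avoiding x) Q) →
                      Clones (_⊆ E) Q
  clones-everywhere {S} S-big cl {f} {q} {A} f∈ q∈ f∉A A⊆E ind =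
    let x , x∈S , x∉ = ∣p∣<∣q∣⇒∃ (A ∪ ⁅ f ⁆) S (≤-<-trans (ind-size ind) S-big) in
    cl x∈S {f} {q} {A} f∈ q∈ f∉A (A⊆E , x∉ ∘ p⊆p∪q ⁅ f ⁆) ind

  module _ (deletions : ∀ {x} → x ∈ E → Represents Ind (Avoiding x)) where

    record CloneClass (b k : ℕ) (P : Subset n) : Set where
      field
        avoided  : Subset n
        class    : Subset n
        avoided⊆ : avoided ⊆ P
        class⊆   : class ⊆ P
        many     : k ≤ ∣ avoided ∣
        big      : b < ∣ class ∣
        clones   : ∀ {x} → x ∈ avoided → Clones (Avoiding x) class

    -- Choose `x` in `P`, pass to a class of edges parallel in the graph of the deletion of `x`, and
    -- continue inside this class. The final class lies in all the chosen ones, hence consists of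
    -- clones for each `x`. Since `x` is outside its own class, the chosen elements are distinct.
    clone-class : ∀ b k P → P ⊆ E → threshold r b k < ∣ P ∣ → CloneClass b k P
    clone-class b zero P P⊆E big = record
      { avoided  = ⊥
      ; class    = P
      ; avoided⊆ = ⊥-elim ∘ ∉⊥
      ; class⊆   = id
      ; many     = z≤n
      ; big      = big
      ; clones   = λ x∈ → ⊥-elim (∉⊥ x∈)
      }
    clone-class b (suc k) P P⊆E big
      with 0<∣p∣⇒nonempty P (≤-<-trans z≤n big)
    ... | x , x∈P = record
      { avoided  = C.avoided ∪ ⁅ x ⁆
      ; class    = C.class
      ; avoided⊆ = ∪-least (P′⊆P ∘ C.avoided⊆) (⁅x⁆⊆ x∈P)
      ; class⊆   = P′⊆P ∘ C.class⊆
      ; many     = ≤-<-trans C.many (x∉p⇒∣p∣<∣p∪⁅x⁆∣ C.avoided (x∉P′ ∘ C.avoided⊆))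
      ; big      = C.big
      ; clones   = clones′
      }
      where
      R = deletions (P⊆E x∈P)
      module P′ = ParallelClass (parallel-class R (threshold r b k) (P - x)
             (P⊆E ∘ p─q⊆p P ⁅ x ⁆ , x∉p-x P x) (s≤s⁻¹ (≤-trans big (∣p∣≤1+∣p-x∣ P x))))
      P′⊆P : P′.class ⊆ P
      P′⊆P = p─q⊆p P ⁅ x ⁆ ∘ P′.class⊆
      x∉P′ : x ∉ P′.class
      x∉P′ = x∉p-x P x ∘ P′.class⊆
      module C = CloneClass (clone-class b k P′.class (P⊆E ∘ P′⊆P) P′.big)
      clones′ : ∀ {y} → y ∈ C.avoided ∪ ⁅ x ⁆ → Clones (Avoiding y) C.class
      clones′ = ∪⁅x⁆-elim (λ y → Clones (Avoiding y) C.class) C.clones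
        (parallel⇒clones R (P⊆E ∘ P′⊆P ∘ C.class⊆ , x∉P′ ∘ C.class⊆) (P′.parallel ∘ C.class⊆))

    -- Putting back a deleted element as a parallel edge.

    -- The graph of the deletion of `f` carries no information about `f`. The edge `f` is redrawn
    -- from `u` to `v`, parallel to the edges of `Q′`; as clones of `f`, these determine how `f`
    -- behaves.
    module _ {f : Fin n} {Q Q′ : Subset n} (Q⊆E : Q ⊆ E) (cl : Clones (_⊆ E) Q) (f∈Q : f ∈ Q)
             (R : Represents Ind (Avoiding f))
             (Q′⊆Q : Q′ ⊆ Q) (f∉Q′ : f ∉ Q′) (Q′-big : 2 < ∣ Q′ ∣)
             {u v : Fin (#vertices R)}
             (par : ∀ {q} → q ∈ Q′ → source R q ≡ u × target R q ≡ v) where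
      private
        s = source R
        t = target R

        redirect : Fin (#vertices R) → (Fin n → Fin (#vertices R)) → Fin n → Fin (#vertices R)
        redirect w g e with e Fin.≟ f
        ... | yes _ = w
        ... | no  _ = g e

        redirect-f : ∀ w g → redirect w g f ≡ w
        redirect-f w g with f Fin.≟ f
        ... | yes _  = refl
        ... | no f≢f = ⊥-elim (f≢f refl)

        redirect-≢ : ∀ w g {e} → e ≢ f → redirect w g e ≡ g e
        redirect-≢ w g {e} e≢f with e Fin.≟ f
        ... | yes e≡f = ⊥-elim (e≢f e≡f)
        ... | no _    = refl

        s′ = redirect u s
        t′ = redirect v t

        agree : ∀ {X} → f ∉ X → Sparse s t X ⇔ Sparse s′ t′ X
        agree {X} f∉X = mk⇔ (sparse-cong λ e∈ → redirect-≢ u s (≢f e∈) , redirect-≢ v t (≢f e∈))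
          (sparse-cong λ e∈ → sym (redirect-≢ u s (≢f e∈)) , sym (redirect-≢ v t (≢f e∈)))
          where
          ≢f : ∀ {e} → e ∈ X → e ≢ f
          ≢f e∈X refl = f∉X e∈X

        par′ : ∀ {q} → q ∈ Q′ → s′ f ≡ s′ q × t′ f ≡ t′ q
        par′ q∈ = trans (redirect-f u s) (trans (sym (proj₁ (par q∈))) (sym (redirect-≢ u s q≢f))) ,
                  trans (redirect-f v t) (trans (sym (proj₂ (par q∈))) (sym (redirect-≢ v t q≢f)))
          where q≢f = λ { refl → f∉Q′ q∈ }

        -- Parallel edges span at most two vertices, or one if `u` and `v` coincide, and `Q′` has at
        -- least three edges.
        Q′-dependent : ¬ Sparse s t Q′
        Q′-dependent sp = <⇒≱ Q′-big (begin
          ∣ Q′ ∣                        ≤⟨ sp Q′ (⁅ u ⁆ ∪ ⁅ v ⁆) id cov ⟩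
          ∣ ⁅ u ⁆ ∪ ⁅ v ⁆ ∣             ≤⟨ ∣p∪q∣≤∣p∣+∣q∣ ⁅ u ⁆ ⁅ v ⁆ ⟩
          ∣ ⁅ u ⁆ ∣ + ∣ ⁅ v ⁆ ∣         ≡⟨ cong₂ _+_ (∣⁅x⁆∣≡1 u) (∣⁅x⁆∣≡1 v) ⟩
          2                             ∎)
          where
          open ≤-Reasoning
          cov : Covers s t (⁅ u ⁆ ∪ ⁅ v ⁆) Q′
          cov q∈ with par q∈
          ... | refl , refl = p⊆p∪q ⁅ v ⁆ (x∈⁅x⁆ u) , q⊆p∪q ⁅ u ⁆ ⁅ v ⁆ (x∈⁅x⁆ v)

        dom : ∀ {A q} → A ⊆ E → f ∉ A → q ∈ Q′ → Avoiding f (A ∪ ⁅ q ⁆)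
        dom {A} {q} A⊆E f∉A q∈ = ∪-least A⊆E (⁅x⁆⊆ (Q⊆E (Q′⊆Q q∈))) ,
          λ f∈ → [ f∉A , (λ f∈q → f∉Q′ (subst (_∈ Q′) (sym (x∈⁅y⁆⇒x≡y q f∈q)) q∈)) ]′
                   (x∈p∪q⁻ A _ f∈)

        -- If X misses some q in Q′, then f is exchanged for q, and the deletion
        -- of f decides; otherwise X contains the dependent set Q′.
        correct′ : ∀ {X} → X ⊆ E → Ind X ⇔ Sparse s′ t′ X
        correct′ {X} X⊆E with f ∈? X
        ... | no f∉X = ⇔-trans (correct R (X⊆E , f∉X)) (agree f∉X)
        ... | yes f∈X with any? (λ q → (q ∈? Q′) ×-dec ¬? (q ∈? X))
        ... | no ∄ = mk⇔
          (λ ind → ⊥-elim (Q′-dependent (to (correct R (Q⊆E ∘ Q′⊆Q , f∉Q′)) (ind-⊆ Q′⊆X ind))))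
          (λ sp → ⊥-elim (Q′-dependent (from (agree f∉Q′) (sparse-⊆ Q′⊆X sp))))
          where
          Q′⊆X : Q′ ⊆ X
          Q′⊆X {q} q∈ = decidable-stable (q ∈? X) λ q∉ → ∄ (q , q∈ , q∉)
        ... | yes (q , q∈ , q∉X) = subst (λ X → Ind X ⇔ Sparse s′ t′ X) (p-x∪⁅x⁆≡p f∈X)
          (⇔-trans (mk⇔ (cl f∈Q (Q′⊆Q q∈) f∉A A⊆E) (cl (Q′⊆Q q∈) f∈Q q∉A A⊆E))
            (⇔-trans (correct R d) (⇔-trans (agree (proj₂ d))
              (mk⇔ (sparse-exchange (sym (proj₁ (par′ q∈))) (sym (proj₂ (par′ q∈))) q∉A)
                   (sparse-exchange (proj₁ (par′ q∈)) (proj₂ (par′ q∈)) f∉A)))))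
          where
          A = X - f
          A⊆E : A ⊆ E
          A⊆E = X⊆E ∘ p─q⊆p X ⁅ f ⁆
          f∉A : f ∉ A
          f∉A = x∉p-x X f
          q∉A : q ∉ A
          q∉A = q∉X ∘ p─q⊆p X ⁅ f ⁆
          d = dom A⊆E f∉A q∈

      extend-parallel : Represents Ind (_⊆ E)
      extend-parallel = record { source = s′ ; target = t′ ; correct = correct′ }

    -- The hypothesis subtracts one because `f` is taken out of `Q` before the parallel class is
    -- sought in the graph of its deletion.
    extend-class : ∀ {Q} → Q ⊆ E → Clones (_⊆ E) Q → 2 * r * (2 * r * 2) < ∣ Q ∣ ∸ 1 →
                   ∀ {f} → f ∈ Q → Represents Ind (_⊆ E)
    extend-class {Q} Q⊆E clones big {f} f∈Q =
      extend-parallel Q⊆E clones f∈Q R (p─q⊆p Q ⁅ f ⁆ ∘ D.class⊆) (x∉p-x Q f ∘ D.class⊆)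
        D.big D.parallel
      where
      R = deletions (Q⊆E f∈Q)
      module D = ParallelClass (parallel-class R 2 (Q - f) (Q⊆E ∘ p─q⊆p Q ⁅ f ⁆ , x∉p-x Q f)
                   (≤-trans big (∸-monoˡ-≤ 1 (∣p∣≤1+∣p-x∣ Q f))))

    large⇒represented : size-bound r < ∣ E ∣ → Represents Ind (_⊆ E)
    large⇒represented big =
      extend-class C.class⊆ (clones-everywhere C.many C.clones) (∸-monoˡ-≤ 1 C.big)
        (proj₂ (0<∣p∣⇒nonempty C.class (≤-<-trans z≤n C.big)))
      where
      module C = CloneClass (clone-class _ (suc r) E id big)

-- Images of sets and transfer of sparsity.

-- The map takes a proof of membership because an isomorphism of matroids acts on ground set
-- elements only.
image : (X : Subset n) → (∀ e → e ∈ X → Fin m) → Subset m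
image []            f = ⊥
image (inside  ∷ X) f = image X (λ e e∈ → f (suc e) (there e∈)) ∪ ⁅ f zero here ⁆
image (outside ∷ X) f = image X (λ e e∈ → f (suc e) (there e∈))

∈-image⁺ : ∀ {X : Subset n} (f : ∀ e → e ∈ X → Fin m) {e} (e∈ : e ∈ X) → f e e∈ ∈ image X f
∈-image⁺ {X = _ ∷ X}       f here       = q⊆p∪q (image X _) _ (x∈⁅x⁆ (f zero here))
∈-image⁺ {X = inside  ∷ _} f (there e∈) = p⊆p∪q _ (∈-image⁺ _ e∈)
∈-image⁺ {X = outside ∷ _} f (there e∈) = ∈-image⁺ _ e∈

∈-image⁻ : ∀ (X : Subset n) (f : ∀ e → e ∈ X → Fin m) {v} → v ∈ image X f →
           ∃ λ e → Σ[ e∈ ∈ e ∈ X ] f e e∈ ≡ v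
∈-image⁻ []            f v∈ = ⊥-elim (∉⊥ v∈)
∈-image⁻ (inside  ∷ X) f v∈ with x∈p∪q⁻ (image X _) _ v∈
... | inj₁ v∈X = let e , e∈ , eq = ∈-image⁻ X _ v∈X in suc e , there e∈ , eq
... | inj₂ v∈f = zero , here , sym (x∈⁅y⁆⇒x≡y _ v∈f)
∈-image⁻ (outside ∷ X) f v∈ = let e , e∈ , eq = ∈-image⁻ X _ v∈ in suc e , there e∈ , eq

image-least : ∀ {X : Subset n} {Y : Subset m} (f : ∀ e → e ∈ X → Fin m) →
              (∀ {e} (e∈ : e ∈ X) → f e e∈ ∈ Y) → image X f ⊆ Y
image-least {X = X} {Y} f f∈ v∈ = let e , e∈ , eq = ∈-image⁻ X f v∈ in subst (_∈ Y) eq (f∈ e∈)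

∣image∣≤ : ∀ (X : Subset n) (f : ∀ e → e ∈ X → Fin m) → ∣ image X f ∣ ≤ ∣ X ∣
∣image∣≤ {m = m} [] f = ≤-reflexive (∣⊥∣≡0 m)
∣image∣≤ (inside  ∷ X) f = ≤-trans (∣p∪q∣≤∣p∣+∣q∣ (image X _) _)
  (≤-trans (≤-reflexive (trans (cong (∣ image X _ ∣ +_) (∣⁅x⁆∣≡1 (f zero here))) (+-comm _ 1)))
           (s≤s (∣image∣≤ X _)))
∣image∣≤ (outside ∷ X) f = ∣image∣≤ X _

InjectiveOn : (X : Subset n) → (∀ e → e ∈ X → Fin m) → Set
InjectiveOn X f = ∀ {e e′} (e∈ : e ∈ X) (e′∈ : e′ ∈ X) → f e e∈ ≡ f e′ e′∈ → e ≡ e′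

∣image∣≥ : ∀ (X : Subset n) (f : ∀ e → e ∈ X → Fin m) → InjectiveOn X f → ∣ X ∣ ≤ ∣ image X f ∣
∣image∣≥ []            f inj = z≤n
∣image∣≥ (inside  ∷ X) f inj = ≤-trans
  (s≤s (∣image∣≥ X _ λ p q eq → suc-injective (inj (there p) (there q) eq)))
  (x∉p⇒∣p∣<∣p∪⁅x⁆∣ (image X _) fresh)
  where
  fresh : f zero here ∉ image X (λ e e∈ → f (suc e) (there e∈))
  fresh v∈ with ∈-image⁻ X _ v∈
  ... | e , e∈ , eq with inj (there e∈) here eq
  ... | ()
∣image∣≥ (outside ∷ X) f inj = ∣image∣≥ X _ λ p q eq → suc-injective (inj (there p) (there q) eq)

∣image∣ : ∀ (X : Subset n) (f : ∀ e → e ∈ X → Fin m) → InjectiveOn X f → ∣ image X f ∣ ≡ ∣ X ∣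
∣image∣ X f inj = ≤-antisym (∣image∣≤ X f) (∣image∣≥ X f inj)

-- A set in `X` with too few covering vertices would be carried to such a set in `Y`. The map `ω`
-- acts on vertex sets instead of vertices, so that it may also drop a vertex.
sparse-reflect :
  ∀ {s t : Fin n → Fin k} {s′ t′ : Fin m → Fin l} {X : Subset n} {Y : Subset m}
  (f : ∀ e → e ∈ X → Fin m) → InjectiveOn X f → (∀ {e} (e∈ : e ∈ X) → f e e∈ ∈ Y) →
  (ω : Subset k → Subset l) → (∀ W → ∣ ω W ∣ ≤ ∣ W ∣) →
  (∀ {W e} (e∈ : e ∈ X) → (s e ∈ W → s′ (f e e∈) ∈ ω W) × (t e ∈ W → t′ (f e e∈) ∈ ω W)) →
  Sparse s′ t′ Y → Sparse s t X
sparse-reflect {s′ = s′} {t′} f inj f∈ ω ∣ω∣≤ ends sp Z W Z⊆X cov = begin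
  ∣ Z ∣            ≤⟨ ∣image∣≥ Z g (λ p q → inj (Z⊆X p) (Z⊆X q)) ⟩
  ∣ image Z g ∣    ≤⟨ sp _ (ω W) (image-least g (λ e∈ → f∈ (Z⊆X e∈))) cov′ ⟩
  ∣ ω W ∣          ≤⟨ ∣ω∣≤ W ⟩
  ∣ W ∣            ∎
  where
  open ≤-Reasoning
  g : ∀ e → e ∈ Z → Fin _
  g e e∈ = f e (Z⊆X e∈)
  cov′ : Covers s′ t′ (ω W) (image Z g)
  cov′ v∈ with ∈-image⁻ Z g v∈
  ... | e , e∈ , refl = proj₁ (ends (Z⊆X e∈)) (proj₁ (cov e∈)) ,
                         proj₂ (ends (Z⊆X e∈)) (proj₂ (cov e∈))

-- The inverse of `f` on its image is itself an injection, and `sparse-reflect` applies to it.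
sparse-image :
  ∀ {s t : Fin n → Fin k} {s′ t′ : Fin m → Fin l} {X : Subset n}
  (f : ∀ e → e ∈ X → Fin m) → InjectiveOn X f →
  (ω : Subset l → Subset k) → (∀ W → ∣ ω W ∣ ≤ ∣ W ∣) →
  (∀ {W e} (e∈ : e ∈ X) → (s′ (f e e∈) ∈ W → s e ∈ ω W) × (t′ (f e e∈) ∈ W → t e ∈ ω W)) →
  Sparse s t X → Sparse s′ t′ (image X f)
sparse-image {s = s} {t} {s′} {t′} {X = X} f inj ω ∣ω∣≤ ends =
  sparse-reflect g g-injective (λ v∈ → proj₁ (proj₂ (∈-image⁻ X f v∈))) ω ∣ω∣≤ ends′
  where
  g : ∀ v → v ∈ image X f → Fin _
  g v v∈ = proj₁ (∈-image⁻ X f v∈)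
  f∘g : ∀ {v} (v∈ : v ∈ image X f) → f _ (proj₁ (proj₂ (∈-image⁻ X f v∈))) ≡ v
  f∘g v∈ = proj₂ (proj₂ (∈-image⁻ X f v∈))
  f-cong : ∀ {e e′} (e∈ : e ∈ X) (e′∈ : e′ ∈ X) → e ≡ e′ → f e e∈ ≡ f e′ e′∈
  f-cong e∈ e′∈ refl = cong (f _) ([]=-irrelevant e∈ e′∈)
  g-injective : InjectiveOn (image X f) g
  g-injective v∈ w∈ eq = trans (sym (f∘g v∈)) (trans (f-cong _ _ eq) (f∘g w∈))
  ends′ : ∀ {W v} (v∈ : v ∈ image X f) →
          (s′ v ∈ W → s (g v v∈) ∈ ω W) × (t′ v ∈ W → t (g v v∈) ∈ ω W)
  ends′ {W} v∈ with ∈-image⁻ X f v∈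
  ... | e , e∈ , refl = ends e∈

-- Independent sets and circuits.

independent? : (M : Matroid n) → Decidable (Independent M)
independent? M X = (X ⊆? ground M) ×-dec (rank M X ≟ ∣ X ∣)

-- By submodularity, the rank of `X` is at most the rank of `Y` plus the size of `X ─ Y`, so a
-- deficit of `Y` would be one of `X`.
independent-⊆ : ∀ (M : Matroid n) {X Y} → Y ⊆ X → Independent M X → Independent M Y
independent-⊆ M {X} {Y} Y⊆X (X⊆E , rX≡) = Y⊆E , ≤-antisym (bounded M Y⊆E)
  (+-cancelʳ-≤ ∣ X ─ Y ∣ ∣ Y ∣ (rank M Y) (begin
    ∣ Y ∣ + ∣ X ─ Y ∣                            ≡⟨ cong (λ Z → ∣ Z ∣ + ∣ X ─ Y ∣) X∩Y≡Y ⟨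
    ∣ X ∩ Y ∣ + ∣ X ─ Y ∣                        ≡⟨ ∣p∣≡∣p∩q∣+∣p─q∣ X Y ⟨
    ∣ X ∣                                        ≡⟨ rX≡ ⟨
    rank M X                                     ≤⟨ monotone M X⊆ (∪-least Y⊆E X─Y⊆E) ⟩
    rank M (Y ∪ (X ─ Y))                         ≤⟨ m≤m+n _ _ ⟩
    rank M (Y ∪ (X ─ Y)) + rank M (Y ∩ (X ─ Y))  ≤⟨ submodular M Y⊆E X─Y⊆E ⟩
    rank M Y + rank M (X ─ Y)                    ≤⟨ +-monoʳ-≤ (rank M Y) (bounded M X─Y⊆E) ⟩
    rank M Y + ∣ X ─ Y ∣                         ∎))
  where
  open ≤-Reasoning
  Y⊆E : Y ⊆ ground M
  Y⊆E = X⊆E ∘ Y⊆X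
  X─Y⊆E : X ─ Y ⊆ ground M
  X─Y⊆E = X⊆E ∘ p─q⊆p X Y
  X∩Y≡Y : X ∩ Y ≡ Y
  X∩Y≡Y = ⊆-antisym (p∩q⊆q X Y) (λ y∈ → x∈p∩q⁺ (Y⊆X y∈ , y∈))
  X⊆ : X ⊆ Y ∪ (X ─ Y)
  X⊆ {x} x∈ with x ∈? Y
  ... | yes x∈Y = p⊆p∪q (X ─ Y) x∈Y
  ... | no x∉Y  = q⊆p∪q Y (X ─ Y) (x∈p∧x∉q⇒x∈p─q x∈ x∉Y)

∣independent∣≤rank : ∀ (M : Matroid n) {X} → Independent M X → ∣ X ∣ ≤ rank M (ground M)
∣independent∣≤rank M (X⊆E , rX≡) = subst (_≤ _) rX≡ (monotone M X⊆E id)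

⊆∧⊉⇒⊂ : ∀ {p q : Subset n} → p ⊆ q → ¬ (q ⊆ p) → p ⊂ q
⊆∧⊉⇒⊂ {p = p} {q} p⊆q q⊈p with any? (λ x → (x ∈? q) ×-dec ¬? (x ∈? p))
... | yes (x , x∈q , x∉p) = p⊆q , x , x∈q , x∉p
... | no ∄ = ⊥-elim (q⊈p λ {x} x∈q → decidable-stable (x ∈? p) λ x∉p → ∄ (x , x∈q , x∉p))

-- By induction on size all proper subsets are independent, so a dependent `X` would itself be a
-- circuit.
circuit-free⇒independent : ∀ (M : Matroid n) {X} → X ⊆ ground M →
                           (∀ {C} → C ⊆ X → ¬ Circuit M C) → Independent M X
circuit-free⇒independent M {X} = go (suc ∣ X ∣) ≤-refl
  where
  go : ∀ b {X} → ∣ X ∣ < b → X ⊆ ground M → (∀ {C} → C ⊆ X → ¬ Circuit M C) → Independent M X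
  go (suc b) {X} ∣X∣< X⊆E none = decidable-stable (independent? M X) λ dep →
    none id (X⊆E , dep , λ Y Y⊂X → go b (≤-trans (p⊂q⇒∣p∣<∣q∣ Y⊂X) (s≤s⁻¹ ∣X∣<))
      (X⊆E ∘ proj₁ Y⊂X) (λ C⊆Y → none (proj₁ Y⊂X ∘ C⊆Y)))

-- Bicycles and sparse sets.

≼-trans : ∀ {G} {H K L : Subgraph G} → H ≼ K → K ≼ L → H ≼ L
≼-trans (v , e) (v′ , e′) = v′ ∘ v , e′ ∘ e

-- A smallest subgraph with more edges than vertices is a bicycle. The induction counts vertices and
-- edges together, since a proper subgraph may lose only one of the two kinds.
bicycle-free⇒¬moreEdges : ∀ {G} {H : Subgraph G} →
                          (∀ {K : Subgraph G} → K ≼ H → ¬ Bicycle K) → ¬ MoreEdges H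
bicycle-free⇒¬moreEdges {G} {H} = go (suc (size H)) {H} ≤-refl
  where
  size : Subgraph G → ℕ
  size H = ∣ vertices H ∣ + ∣ edges H ∣
  go : ∀ b {H : Subgraph G} → size H < b →
       (∀ {K : Subgraph G} → K ≼ H → ¬ Bicycle K) → ¬ MoreEdges H
  go (suc b) {H} size< none more = none {H} (id , id) (more , minimal)
    where
    minimal : ∀ K → K ≼ H → MoreEdges K → H ≼ K
    minimal K K≼H@(V⊆ , E⊆) K-more
      with vertices H ⊆? vertices K | edges H ⊆? edges K
    ... | yes V⊇ | yes E⊇ = V⊇ , E⊇
    ... | no V⊉  | _ = ⊥-elim (go b {K} (<-≤-trans
      (+-mono-<-≤ (p⊂q⇒∣p∣<∣q∣ (⊆∧⊉⇒⊂ V⊆ V⊉)) (p⊆q⇒∣p∣≤∣q∣ E⊆)) (s≤s⁻¹ size<))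
      (λ {L} L≼K → none {L} (≼-trans {H = L} {K} {H} L≼K K≼H)) K-more)
    ... | yes _  | no E⊉ = ⊥-elim (go b {K} (<-≤-trans
      (+-mono-≤-< (p⊆q⇒∣p∣≤∣q∣ V⊆) (p⊂q⇒∣p∣<∣q∣ (⊆∧⊉⇒⊂ E⊆ E⊉))) (s≤s⁻¹ size<))
      (λ {L} L≼K → none {L} (≼-trans {H = L} {K} {H} L≼K K≼H)) K-more)

EdgeSparse : (G : Graph) → Subset (#E G) → Set
EdgeSparse G = Sparse (end₁ G) (end₂ G)

subgraph : ∀ (G : Graph) {W Y} → Covers (end₁ G) (end₂ G) W Y → Subgraph G
subgraph G {W} {Y} cov = record
  { vertices = W ; edges = Y ; closed₁ = proj₁ ∘ cov ; closed₂ = proj₂ ∘ cov }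

covered : ∀ {G} (H : Subgraph G) → Covers (end₁ G) (end₂ G) (vertices H) (edges H)
covered H e∈ = closed₁ H e∈ , closed₂ H e∈

moreEdges⇒¬sparse : ∀ {G} (H : Subgraph G) → MoreEdges H → ¬ EdgeSparse G (edges H)
moreEdges⇒¬sparse H more sp = <⇒≱ more (sp (edges H) (vertices H) id (covered H))

-- A violation of sparsity contains a bicycle, whose edge set is dependent. Conversely, a circuit is
-- the edge set of a bicycle and violates sparsity.
independent⇔sparse : ∀ {G B} → IsBicircularMatroidOf G B → ∀ {X} → Independent B X ⇔ EdgeSparse G X
independent⇔sparse {G} {B} (ground≡ , circuits) {X} = mk⇔ ⇒ ⇐
  where
  ⇒ : Independent B X → EdgeSparse G X
  ⇒ ind Y W Y⊆X cov = ≮⇒≥ (bicycle-free⇒¬moreEdges {H = subgraph G cov} λ {K} K≼H K-bicycle →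
    proj₁ (proj₂ (from (circuits (edges K)) (K , K-bicycle , refl)))
      (independent-⊆ B (Y⊆X ∘ proj₂ K≼H) ind))
  ⇐ : EdgeSparse G X → Independent B X
  ⇐ sp = circuit-free⇒independent B (λ _ → subst (_ ∈_) (sym ground≡) ∈⊤) no-circuit
    where
    no-circuit : ∀ {C} → C ⊆ X → ¬ Circuit B C
    no-circuit {C} C⊆X C-circuit with to (circuits C) C-circuit
    ... | H , (more , _) , refl = moreEdges⇒¬sparse H more (sparse-⊆ C⊆X sp)

sparse⇒bicircular : ∀ G (B : Matroid (#E G)) → ground B ≡ ⊤ →
                    (∀ {X} → Independent B X ⇔ EdgeSparse G X) → IsBicircularMatroidOf G B
sparse⇒bicircular G B ground≡ ind⇔ = ground≡ , λ X → mk⇔ (⇒ X) ⇐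
  where
  ⇒ : ∀ X → Circuit B X → ∃[ H ] (Bicycle {G} H × edges H ≡ X)
  ⇒ X (X⊆E , dep , minimal) = H , (more , least) , refl
    where
    -- The set of all ends of `X` is the least vertex set that covers `X`.
    V = image X (λ e _ → end₁ G e) ∪ image X (λ e _ → end₂ G e)
    V-covers : Covers (end₁ G) (end₂ G) V X
    V-covers e∈ = p⊆p∪q _ (∈-image⁺ (λ e _ → end₁ G e) e∈)
                , q⊆p∪q (image X (λ e _ → end₁ G e)) _ (∈-image⁺ (λ e _ → end₂ G e) e∈)
    V-least : ∀ {W} → Covers (end₁ G) (end₂ G) W X → V ⊆ W
    V-least cov = ∪-least (image-least _ (proj₁ ∘ cov)) (image-least _ (proj₂ ∘ cov))
    H = subgraph G V-covers
    more : MoreEdges H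
    -- Proper subsets of `X` are independent, hence sparse. Only `X` itself can violate sparsity,
    -- and any `W` that covers it contains `V`.
    more = ≰⇒> λ X≤V → dep (from ind⇔ λ Y W Y⊆X cov → sparse X≤V Y⊆X cov)
      where
      sparse : ∣ X ∣ ≤ ∣ V ∣ → ∀ {Y W} → Y ⊆ X → Covers (end₁ G) (end₂ G) W Y → ∣ Y ∣ ≤ ∣ W ∣
      sparse X≤V {Y} {W} Y⊆X cov with X ⊆? Y
      ... | yes X⊆Y = ≤-trans (p⊆q⇒∣p∣≤∣q∣ Y⊆X) (≤-trans X≤V (p⊆q⇒∣p∣≤∣q∣ (V-least (cov ∘ X⊆Y))))
      ... | no X⊈Y  = to ind⇔ (minimal Y (⊆∧⊉⇒⊂ Y⊆X X⊈Y)) Y W id cov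
    least : ∀ K → K ≼ H → MoreEdges K → H ≼ K
    least K (_ , K⊆X) K-more = V-least (covered K ∘ X⊆K) , X⊆K
      where
      X⊆K : X ⊆ edges K
      X⊆K = decidable-stable (X ⊆? edges K) (λ X⊈K →
        moreEdges⇒¬sparse K K-more (to ind⇔ (minimal (edges K) (⊆∧⊉⇒⊂ K⊆X X⊈K))))
  ⇐ : ∀ {X} → ∃[ H ] (Bicycle {G} H × edges H ≡ X) → Circuit B X
  ⇐ (H , (more , least) , refl) =
    (λ _ → subst (_ ∈_) (sym ground≡) ∈⊤) , moreEdges⇒¬sparse H more ∘ to ind⇔ , proper
    where
    proper : ∀ Y → Y ⊂ edges H → Independent B Y
    proper Y (Y⊆ , e , e∈H , e∉Y) = from ind⇔ λ Z W Z⊆Y cov → ≮⇒≥ λ W<Z →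
      -- A violation inside `Y` is cut down to the vertices of `H`, so that it becomes a subgraph of
      -- `H`. Minimality of `H` then forces `e` into `Y`.
      let K = subgraph G {W ∩ vertices H} {Z} λ z∈ →
                x∈p∩q⁺ (proj₁ (cov z∈) , closed₁ H (Y⊆ (Z⊆Y z∈))) ,
                x∈p∩q⁺ (proj₂ (cov z∈) , closed₂ H (Y⊆ (Z⊆Y z∈)))
          H≼K = least K (p∩q⊆q W (vertices H) , Y⊆ ∘ Z⊆Y)
                  (≤-<-trans (∣p∩q∣≤∣p∣ W (vertices H)) W<Z)
      in e∉Y (Z⊆Y (proj₂ H≼K e∈H))

-- Loops, isomorphisms, and graphs of bicircular matroids.

nonloops : Matroid n → Subset n
nonloops M = ground M ─ loops M

∈-nonloops : ∀ (M : Matroid n) {e} → e ∈ nonloops M ⇔ (e ∈ ground M × rank M ⁅ e ⁆ ≢ 0)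
∈-nonloops M {e} = mk⇔
  (λ e∈ → let e∈E = p─q⊆p (ground M) (loops M) e∈ in
    e∈E , λ r≡0 → x∈p─q⇒x∉q (ground M) (loops M) e∈ (x∈p∩q⁺ (e∈E , from zero-rank r≡0)))
  (λ (e∈E , r≢0) → x∈p∧x∉q⇒x∈p─q e∈E λ e∈loops →
    r≢0 (to zero-rank (proj₂ (x∈p∩q⁻ (ground M) _ e∈loops))))
  where
  zero-rank : ∀ {e} → e ∈ comprehension (λ e → rank M ⁅ e ⁆ ≟ 0) ⇔ rank M ⁅ e ⁆ ≡ 0
  zero-rank = ∈-comprehension (λ e → rank M ⁅ e ⁆ ≟ 0)

element-≡ : ∀ (M : Matroid n) {x y : Element M} → proj₁ x ≡ proj₁ y → x ≡ y
element-≡ M {e , p} {_ , q} refl = cong (e ,_) ([]=-irrelevant p q)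

module Isomorphism {M : Matroid n} {N : Matroid m} (iso : M ≅ N)
                   {X : Subset n} (X⊆E : X ⊆ ground M) where
  private
    φ = proj₁ iso

  map-element : ∀ e → e ∈ X → Fin m
  map-element e e∈ = proj₁ (Inverse.to φ (e , X⊆E e∈))

  map-injective : InjectiveOn X map-element
  map-injective p q eq = cong proj₁ (Injection.injective (↔⇒↣ φ) (element-≡ N eq))

  image⊆ground : image X map-element ⊆ ground N
  image⊆ground = image-least map-element λ e∈ → proj₂ (Inverse.to φ (_ , X⊆E e∈))

  -- `_≅_` compares only sets that correspond under the bijection; the image of `X` corresponds to
  -- `X` because `φ` is injective.
  rank-image : rank M X ≡ rank N (image X map-element)
  rank-image = proj₂ iso X _ X⊆E image⊆ground corresponds
    where
    corresponds : ∀ (x : Element M) → proj₁ x ∈ X ⇔ proj₁ (Inverse.to φ x) ∈ image X map-element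
    corresponds x@(e , p) = mk⇔
      (λ e∈ → subst (λ y → proj₁ (Inverse.to φ y) ∈ image X map-element)
                (element-≡ M refl) (∈-image⁺ map-element e∈))
      (λ v∈ → let e′ , e′∈ , eq = ∈-image⁻ X map-element v∈ in
              subst (_∈ X) (cong proj₁ (Injection.injective (↔⇒↣ φ) (element-≡ N eq))) e′∈)

  independent-image : Independent M X ⇔ Independent N (image X map-element)
  independent-image = mk⇔
    (λ (_ , eq) → image⊆ground , trans (sym rank-image) (trans eq (sym card)))
    (λ (_ , eq) → X⊆E , trans rank-image (trans eq card))
    where
    card = ∣image∣ X map-element map-injective

∣tail∣≤ : ∀ (W : Subset (suc n)) → ∣ tail W ∣ ≤ ∣ W ∣
∣tail∣≤ (x ∷ W) = ∣p∣≤∣x∷p∣ x W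

bicircular⇒represents : ∀ {M : Matroid n} → Bicircular M →
                        Represents (Independent M) (_⊆ nonloops M)
bicircular⇒represents {n = n} {M} (G , B , isB , iso) = record
  { source = extend (end₁ G) ; target = extend (end₂ G) ; correct = correct′ }
  where
  φ = proj₁ iso

  -- The vertex zero is added so that the ends are also defined for labels of
  -- loops and for labels outside the ground set.
  extend : (Fin (#E G) → Fin (#V G)) → Fin n → Fin (suc (#V G))
  extend end e with e ∈? nonloops M
  ... | yes e∈ = suc (end (proj₁ (Inverse.to φ (e , e∈))))
  ... | no _   = zero

  extend-≡ : ∀ end {e} (e∈ : e ∈ nonloops M) →
             extend end e ≡ suc (end (proj₁ (Inverse.to φ (e , e∈))))
  extend-≡ end {e} e∈ with e ∈? nonloops M
  ... | yes e∈′ = cong (λ p → suc (end (proj₁ (Inverse.to φ (e , p))))) ([]=-irrelevant e∈′ e∈)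
  ... | no e∉   = ⊥-elim (e∉ e∈)

  correct′ : ∀ {X} → X ⊆ nonloops M →
             Independent M X ⇔ Sparse (extend (end₁ G)) (extend (end₂ G)) X
  correct′ {X} X⊆ = ⇔-trans without-loops (⇔-trans independent-image
    (⇔-trans (independent⇔sparse {B = B} isB) (mk⇔
      -- The vertex `zero` is an end of no edge in `X`: `tail` drops it from vertex sets, and
      -- `outside ∷_` carries sets back without it.
      (sparse-reflect map-element map-injective (∈-image⁺ map-element) tail ∣tail∣≤
        (λ {W} e∈ → down (end₁ G) {W} (X⊆ e∈) , down (end₂ G) {W} (X⊆ e∈)))
      (sparse-image map-element map-injective (outside ∷_) (λ _ → ≤-refl)
        (λ e∈ → up (end₁ G) (X⊆ e∈) , up (end₂ G) (X⊆ e∈))))))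
    where
    without-loops : Independent M X ⇔ Independent (delete M (loops M)) X
    without-loops = mk⇔ (λ (_ , eq) → X⊆ , eq) (λ (_ , eq) → p─q⊆p (ground M) (loops M) ∘ X⊆ , eq)
    open Isomorphism {M = delete M (loops M)} {N = B} iso X⊆
    down : ∀ end {W e} (e∈ : e ∈ nonloops M) → extend end e ∈ W →
           end (proj₁ (Inverse.to φ (e , e∈))) ∈ tail W
    down end {_ ∷ W} e∈ v∈ = drop-there (subst (_∈ _ ∷ W) (extend-≡ end e∈) v∈)
    up : ∀ end {W e} (e∈ : e ∈ nonloops M) → end (proj₁ (Inverse.to φ (e , e∈))) ∈ W →
         extend end e ∈ outside ∷ W
    up end {W} e∈ v∈ = subst (_∈ outside ∷ W) (sym (extend-≡ end e∈)) (there v∈)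

-- Relabelling the ground set.

embed : (p : Subset n) → Fin ∣ p ∣ → Fin n
embed (inside  ∷ p) zero    = zero
embed (inside  ∷ p) (suc i) = suc (embed p i)
embed (outside ∷ p) i       = suc (embed p i)

embed-∈ : ∀ (p : Subset n) i → embed p i ∈ p
embed-∈ (inside  ∷ p) zero    = here
embed-∈ (inside  ∷ p) (suc i) = there (embed-∈ p i)
embed-∈ (outside ∷ p) i       = there (embed-∈ p i)

embed-injective : ∀ (p : Subset n) {i j} → embed p i ≡ embed p j → i ≡ j
embed-injective (inside  ∷ p) {zero}  {zero}  _  = refl
embed-injective (inside  ∷ p) {suc i} {suc j} eq = cong suc (embed-injective p (suc-injective eq))
embed-injective (outside ∷ p)                 eq = embed-injective p (suc-injective eq)

index : ∀ {p : Subset n} {e} → e ∈ p → Fin ∣ p ∣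
index {p = inside  ∷ p} here       = zero
index {p = inside  ∷ p} (there e∈) = suc (index e∈)
index {p = outside ∷ p} (there e∈) = index e∈

embed-index : ∀ {p : Subset n} {e} (e∈ : e ∈ p) → embed p (index e∈) ≡ e
embed-index {p = inside  ∷ p} here       = refl
embed-index {p = inside  ∷ p} (there e∈) = cong suc (embed-index e∈)
embed-index {p = outside ∷ p} (there e∈) = cong suc (embed-index e∈)

embed[_] : (p : Subset n) → Subset ∣ p ∣ → Subset n
embed[ p ] X = image X λ i _ → embed p i

embed[]⊆ : ∀ (p : Subset n) X → embed[ p ] X ⊆ p
embed[]⊆ p X = image-least {X = X} _ λ {i} _ → embed-∈ p i

embed[]-mono : ∀ (p : Subset n) {X Y} → X ⊆ Y → embed[ p ] X ⊆ embed[ p ] Y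
embed[]-mono p {Y = Y} X⊆Y = image-least _ λ i∈ → ∈-image⁺ {X = Y} _ (X⊆Y i∈)

∣embed[]∣ : ∀ (p : Subset n) X → ∣ embed[ p ] X ∣ ≡ ∣ X ∣
∣embed[]∣ p X = ∣image∣ X _ λ _ _ → embed-injective p

-- The matroid of a graph must have all labels in its ground set, and the enumeration below lists
-- matroids of this form.
relabel : (M : Matroid n) → Matroid ∣ ground M ∣
relabel M = record
  { ground     = ⊤
  ; rank       = λ X → rank M (embed[ E ] X)
  ; bounded    = λ {X} _ → ≤-trans (bounded M (embed[]⊆ E X)) (≤-reflexive (∣embed[]∣ E X))
  ; monotone   = λ {X} {Y} X⊆Y _ → monotone M (embed[]-mono E X⊆Y) (embed[]⊆ E Y)
  -- The embedded union and intersection lie in the union and intersection of the embedded sets, so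
  -- monotonicity reduces this to submodularity of `M`.
  ; submodular = λ {X} {Y} _ _ → ≤-trans
      (+-mono-≤
        (monotone M (union X Y) (∪-least (embed[]⊆ E X) (embed[]⊆ E Y)))
        (monotone M (λ e∈ → x∈p∩q⁺ (embed[]-mono E (p∩q⊆p X Y) e∈ , embed[]-mono E (p∩q⊆q X Y) e∈))
          (embed[]⊆ E X ∘ p∩q⊆p (embed[ E ] X) (embed[ E ] Y))))
      (submodular M (embed[]⊆ E X) (embed[]⊆ E Y))
  }
  where
  E = ground M
  union : ∀ X Y → embed[ E ] (X ∪ Y) ⊆ embed[ E ] X ∪ embed[ E ] Y
  union X Y = image-least _ λ i∈ →
    [ (λ i∈X → p⊆p∪q _ (∈-image⁺ _ i∈X)) , (λ i∈Y → q⊆p∪q (embed[ E ] X) _ (∈-image⁺ _ i∈Y)) ]′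
      (x∈p∪q⁻ X Y i∈)

-- Agreement of ranks is asked pointwise, the form in which the enumeration provides it.
≅-relabelled : ∀ (M : Matroid n) (N : Matroid ∣ ground M ∣) → ground N ≡ ⊤ →
               (∀ X → rank N X ≡ rank (relabel M) X) → M ≅ N
≅-relabelled M N ground≡ rank≡ = φ , rank-≡
  where
  φ : Element M ↔ Element N
  φ = mk↔ₛ′ (λ (e , e∈) → index e∈ , subst (_ ∈_) (sym ground≡) ∈⊤)
            (λ (i , _) → embed (ground M) i , embed-∈ (ground M) i)
            (λ (i , _) → element-≡ N (embed-injective (ground M) (embed-index (embed-∈ (ground M) i))))
            (λ (e , e∈) → element-≡ M (embed-index e∈))
  rank-≡ : ∀ X Y → X ⊆ ground M → Y ⊆ ground N →
           (∀ x → proj₁ x ∈ X ⇔ proj₁ (Inverse.to φ x) ∈ Y) → rank M X ≡ rank N Y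
  rank-≡ X Y X⊆ Y⊆ X⇔Y = trans (cong (rank M) (⊆-antisym
    (λ e∈ → subst (_∈ embed[ ground M ] Y) (embed-index (X⊆ e∈))
              (∈-image⁺ _ (to (X⇔Y (_ , X⊆ e∈)) e∈)))
    (image-least _ λ {i} i∈Y → from (X⇔Y (_ , embed-∈ (ground M) i))
       (subst (_∈ Y) (sym (embed-injective (ground M) (embed-index (embed-∈ (ground M) i)))) i∈Y))))
    (sym (rank≡ Y))

-- The graph keeps all vertices of `R` and only the edges of non-loops, so vertex sets transfer by
-- the identity.
represents⇒bicircular : ∀ {M : Matroid n} → Represents (Independent M) (_⊆ nonloops M) →
                        Bicircular M
represents⇒bicircular {M = M} R =
  G , B , sparse⇒bicircular G B refl ind⇔ , ≅-relabelled N B refl (λ _ → refl)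
  where
  N = delete M (loops M)
  B = relabel N
  ι = embed (nonloops M)
  G : Graph
  G = record { #V = #vertices R ; #E = ∣ nonloops M ∣
             ; end₁ = source R ∘ ι ; end₂ = target R ∘ ι }
  ind⇔ : ∀ {X} → Independent B X ⇔ EdgeSparse G X
  ind⇔ {X} = ⇔-trans embedded (⇔-trans (correct R (embed[]⊆ (nonloops M) X)) (mk⇔
      (sparse-reflect (λ i _ → ι i) inj (∈-image⁺ _) id (λ _ → ≤-refl) (λ _ → id , id))
      (sparse-image (λ i _ → ι i) inj id (λ _ → ≤-refl) (λ _ → id , id))))
    where
    embedded : Independent B X ⇔ Independent M (embed[ nonloops M ] X)
    embedded = mk⇔
      (λ (_ , eq) → p─q⊆p (ground M) (loops M) ∘ embed[]⊆ (nonloops M) X ,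
                    trans eq (sym (∣embed[]∣ (nonloops M) X)))
      (λ (_ , eq) → ⊆-max X , trans eq (∣embed[]∣ (nonloops M) X))
    inj : InjectiveOn X (λ i _ → ι i)
    inj _ _ = embed-injective (nonloops M)

-- Size of an excluded minor.

module _ {M : Matroid n} (excluded : ExcludedMinor M) where

  deletion-represents : ∀ {x} → x ∈ ground M →
                        Represents (Independent M) (λ X → X ⊆ nonloops M × x ∉ X)
  deletion-represents {x} x∈E = record
    { source  = source R
    ; target  = target R
    ; correct = λ (X⊆ , x∉X) →
        ⇔-trans (independent⇔ X⊆ x∉X) (correct R (X⊆nonloops X⊆ x∉X))
    }
    where
    ⊥⊆E : ⊥ ⊆ ground M
    ⊥⊆E = ⊥-elim ∘ ∉⊥
    -- Proper minors arise by a contraction followed by a deletion; here the empty set is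
    -- contracted, which leaves ranks unchanged.
    N = delete (contract M ⊥ ⊥⊆E) ⁅ x ⁆
    R = bicircular⇒represents {M = N} (proj₂ excluded ⊥ ⁅ x ⁆ ⊥⊆E (⁅x⁆⊆ x∈E)
          (λ (_ , e∈) → ∉⊥ (p∩q⊆p ⊥ ⁅ x ⁆ e∈)) (x , q⊆p∪q ⊥ ⁅ x ⁆ (x∈⁅x⁆ x)))
    rank-≡ : ∀ X → rank N X ≡ rank M X
    rank-≡ X = cong₂ _∸_ (cong (rank M) (∪-identityʳ X))
      (n≤0⇒n≡0 (≤-trans (bounded M ⊥⊆E) (≤-reflexive (∣⊥∣≡0 n))))
    ground⊆ : ground N ⊆ ground M
    ground⊆ = p─q⊆p (ground M) ⊥ ∘ p─q⊆p (ground M ─ ⊥) ⁅ x ⁆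
    module _ {X} (X⊆ : X ⊆ nonloops M) (x∉X : x ∉ X) where
      X⊆ground : X ⊆ ground N
      X⊆ground e∈ = x∈p∧x≢y⇒x∈p-y
        (x∈p∧x∉q⇒x∈p─q (proj₁ (to (∈-nonloops M) (X⊆ e∈))) ∉⊥) λ { refl → x∉X e∈ }
      X⊆nonloops : X ⊆ nonloops N
      X⊆nonloops e∈ = from (∈-nonloops N) (X⊆ground e∈ ,
        λ r≡0 → proj₂ (to (∈-nonloops M) (X⊆ e∈)) (trans (sym (rank-≡ _)) r≡0))
      independent⇔ : Independent M X ⇔ Independent N X
      independent⇔ = mk⇔ (λ (_ , eq) → X⊆ground , trans (rank-≡ X) eq)
                         (λ (_ , eq) → ground⊆ ∘ X⊆ground , trans (sym (rank-≡ X)) eq)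

  -- Sets of non-loops avoid a loop `x` automatically. The graph of the deletion of `x` would
  -- therefore represent `M`.
  ground⊆nonloops : ground M ⊆ nonloops M
  ground⊆nonloops {x} x∈E = from (∈-nonloops M) (x∈E , λ r≡0 →
    proj₁ excluded (represents⇒bicircular {M = M} (record
      { source  = source R
      ; target  = target R
      ; correct = λ X⊆ → correct R (X⊆ , λ x∈X → proj₂ (to (∈-nonloops M) (X⊆ x∈X)) r≡0)
      })))
    where
    R = deletion-represents x∈E


  ∣ground∣≤ : ∀ r → rank M (ground M) ≤ r → ∣ ground M ∣ ≤ size-bound r
  ∣ground∣≤ r rank≤ = ≮⇒≥ λ large → proj₁ excluded (represents⇒bicircular {M = M}
    (large⇒represented (nonloops M) (Independent M) r
      (λ ind → ≤-trans (∣independent∣≤rank M ind) rank≤) (independent-⊆ M)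
      (λ x∈ → deletion-represents (proj₁ (to (∈-nonloops M) x∈)))
      (<-≤-trans large (p⊆q⇒∣p∣≤∣q∣ ground⊆nonloops))))

-- Enumeration of the matroids of bounded size.

private variable
  T : Set

branch : (Subset n → T) → (Subset n → T) → Subset (suc n) → T
branch f g (inside  ∷ X) = f X
branch f g (outside ∷ X) = g X

functions : ∀ n → List T → List (Subset n → T)
functions zero    ys = List.map (λ y _ → y) ys
functions (suc n) ys = concatMap (λ f → List.map (branch f) (functions n ys)) (functions n ys)

-- A function on subsets splits into two, according to whether the first label is inside, and each
-- half is found by induction.
functions-complete : ∀ {ys : List T} (f : Subset n → T) → (∀ X → f X ∈ˡ ys) →
                     Any (λ g → ∀ X → g X ≡ f X) (functions n ys)
functions-complete {n = zero} f f∈ = map⁺ (Any.map (λ { refl [] → refl }) (f∈ []))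
functions-complete {n = suc n} f f∈ = concatMap⁺ _ (Any.map
  (λ g≡ → map⁺ (Any.map (λ h≡ → λ { (inside ∷ X) → g≡ X ; (outside ∷ X) → h≡ X })
    (functions-complete (f ∘ (outside ∷_)) (f∈ ∘ (outside ∷_)))))
  (functions-complete (f ∘ (inside ∷_)) (f∈ ∘ (inside ∷_))))

-- The matroid axioms for a ground set of all labels, quantified over all subsets so that they can
-- be tested.
IsRank : (Subset n → ℕ) → Set
IsRank r = (∀ X → r X ≤ ∣ X ∣)
         × (∀ X Y → X ⊆ Y → r X ≤ r Y)
         × (∀ X Y → r (X ∪ Y) + r (X ∩ Y) ≤ r X + r Y)

allSubsets? : {P : Subset n → Set} → Decidable P → Dec (∀ X → P X)
allSubsets? P? with anySubset? (λ X → ¬? (P? X))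
... | yes (X , ¬p) = no λ p → ¬p (p X)
... | no ∄         = yes λ X → decidable-stable (P? X) λ ¬p → ∄ (X , ¬p)

isRank? : Decidable (IsRank {n})
isRank? r = allSubsets? (λ X → r X ≤? ∣ X ∣)
      ×-dec allSubsets? (λ X → allSubsets? λ Y → (X ⊆? Y) →-dec (r X ≤? r Y))
      ×-dec allSubsets? (λ X → allSubsets? λ Y → r (X ∪ Y) + r (X ∩ Y) ≤? r X + r Y)

fromRank : (r : Subset n → ℕ) → IsRank r → Matroid n
fromRank r (bnd , mono , sub) = record
  { ground     = ⊤
  ; rank       = r
  ; bounded    = λ {X} _ → bnd X
  ; monotone   = λ {X} {Y} X⊆Y _ → mono X Y X⊆Y
  ; submodular = λ {X} {Y} _ _ → sub X Y
  }

fromRank? : (Subset n → ℕ) → List (Matroid n)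
fromRank? r with isRank? r
... | yes p = fromRank r p ∷ []
... | no _  = []

isRank-cong : ∀ {r s : Subset n → ℕ} → (∀ X → s X ≡ r X) → IsRank r → IsRank s
isRank-cong s≡r (bnd , mono , sub)
  = (λ X → subst (_≤ _) (sym (s≡r X)) (bnd X))
  , (λ X Y X⊆Y → subst₂ _≤_ (sym (s≡r X)) (sym (s≡r Y)) (mono X Y X⊆Y))
  , (λ X Y → subst₂ _≤_ (sym (cong₂ _+_ (s≡r (X ∪ Y)) (s≡r (X ∩ Y))))
                        (sym (cong₂ _+_ (s≡r X) (s≡r Y))) (sub X Y))

-- Ranks are at most `n`, so `upTo (suc n)` holds all possible values.
matroids : ∀ n → List (Matroid n)
matroids n = concatMap fromRank? (functions n (upTo (suc n)))

matroids-complete : ∀ (N : Matroid n) → ground N ≡ ⊤ →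
                    Any (λ N′ → ground N′ ≡ ⊤ × (∀ X → rank N′ X ≡ rank N X)) (matroids n)
matroids-complete {n = n} N ground≡ = concatMap⁺ fromRank?
  (Any.map listed (functions-complete (rank N) λ X →
    ∈-upTo⁺ (s≤s (≤-trans (bounded N (all⊆ X)) (∣p∣≤n X)))))
  where
  all⊆ : ∀ X → X ⊆ ground N
  all⊆ X _ = subst (_ ∈_) (sym ground≡) ∈⊤
  isRank : IsRank (rank N)
  isRank = (λ X → bounded N (all⊆ X))
         , (λ X Y X⊆Y → monotone N X⊆Y (all⊆ Y))
         , (λ X Y → submodular N (all⊆ X) (all⊆ Y))
  listed : ∀ {r} → (∀ X → r X ≡ rank N X) →
           Any (λ N′ → ground N′ ≡ ⊤ × (∀ X → rank N′ X ≡ rank N X)) (fromRank? r)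
  listed {r} r≡ with isRank? r
  ... | yes _ = here (refl , r≡)
  ... | no ¬p = ⊥-elim (¬p (isRank-cong r≡ isRank))

matroidsOn : ℕ → List (∃ Matroid)
matroidsOn n = List.map (n ,_) (matroids n)

matroidsUpTo : ℕ → List (∃ Matroid)
matroidsUpTo b = concatMap matroidsOn (upTo (suc b))

matroidsUpTo-complete : ∀ (M : Matroid n) b → ∣ ground M ∣ ≤ b →
                        Any (λ N → M ≅ proj₂ N) (matroidsUpTo b)
matroidsUpTo-complete M b size≤ = concatMap⁺ matroidsOn (Any.map
  (λ { refl → map⁺ (Any.map (λ {N} (ground≡ , rank≡) → ≅-relabelled M N ground≡ rank≡)
                     (matroids-complete (relabel M) refl)) })
  (∈-upTo⁺ (s≤s size≤)))

-- Finiteness for bounded rank.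

-- The list represents all matroids with at most `size-bound r` elements, excluded minors or not; by
-- the size bound, the excluded minors of rank at most `r` are among them.
finitely-many : ∀ r → Σ (List (∃ Matroid)) λ L →
  ∀ {n : ℕ} (M : Matroid n) → ExcludedMinor M → rank M (ground M) ≤ r →
  Any (λ N → M ≅ proj₂ N) L
finitely-many r = matroidsUpTo (size-bound r) ,
  λ M excluded rank≤ → matroidsUpTo-complete M (size-bound r) (∣ground∣≤ {M = M} excluded r rank≤)

theorem7p1 : Σ (List (∃ Matroid)) λ L →
    ∀ {n : ℕ} (M : Matroid n) → ExcludedMinor M → rank M (ground M) < 10 →
    Any (λ N → M ≅ proj₂ N) L
theorem7p1 = proj₁ (finitely-many 9) , λ M excluded rank< →
  proj₂ (finitely-many 9) M excluded (s≤s⁻¹ rank<)
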